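{- The series $\sum_{k=1}^{\infty}\frac{\mu(k)}{F_k}$ converges, i.e. $\lim_{n\to\infty}\sum_{k=1}^{n}\frac{\mu(k)}{F_k}=C$ for a constant $C\approx -0.64572472\cdots$. Moreover, for all integers $n\ge 3$, \[ \sum_{k=1}^{n}\frac{\mu(k)}{F_k}<0. \]
   Context: The Fibonacci numbers are $F_1=F_2=1$, $F_n=F_{n-1}+F_{n-2}$ for $n\ge 3$. $\mu$ denotes the Möbius function: $\mu(1)=1$, $\mu(j)=0$ if $j$ has a repeated prime factor, and $\mu(j)=(-1)^k$ if $j$ is a product of $k$ distinct primes. -}

module Defs where

open import Data.Bool.Base using (if_then_else_)
open import Data.Empty using (⊥)
open import Data.Integer.Base as ℤ using (ℤ; 0ℤ; -1ℤ)
open import Data.List.Base using (length)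
open import Data.List.Relation.Unary.Unique.DecPropositional using (unique?)
open import Data.Nat.Base as ℕ using (ℕ; zero; suc; NonZero)
open import Data.Nat.Primality.Factorisation using (factorise; factors)
import Data.Nat.Properties as ℕₚ
open import Data.Product.Base using (∃-syntax; _×_)
open import Data.Rational.Base using (ℚ; 0ℚ; _/_; _+_; _-_; _<_)
open import Data.Sum.Base using (_⊎_)
open import Relation.Nullary.Decidable.Core using (does)

-- F 0 = 0 extends the sequence F 1 = F 2 = 1 backwards by one term; it is not
-- used by partialSum.
F : ℕ → ℕ
F 0 = 0
F 1 = 1
F (suc (suc n)) = F (suc n) ℕ.+ F n

F-nonZero : ∀ n → NonZero (F (suc n))
F-nonZero zero    = _
F-nonZero (suc n) = ℕ.>-nonZero
  (ℕₚ.<-≤-trans (ℕ.>-nonZero⁻¹ (F (suc n)) {{F-nonZero n}})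
                (ℕₚ.m≤m+n (F (suc n)) (F n)))

-- factors lists the prime factors of n with multiplicity, so n has a repeated
-- prime factor exactly when this list has a duplicate.
μ : ∀ n → .{{NonZero n}} → ℤ
μ n = if does (unique? ℕₚ._≟_ ps) then -1ℤ ℤ.^ length ps else 0ℤ
  where ps = factors (factorise n)

-- partialSum n = Σ_{k=1}^{n} μ(k) / F_k
partialSum : ℕ → ℚ
partialSum zero    = 0ℚ
partialSum (suc n) = partialSum n + (μ (suc n) / F (suc n)) {{F-nonZero n}}

-- Real numbers as located two-sided Dedekind cuts: L q means q < x and
-- U q means x < q.
record ℝ : Set₁ where
  field
    L U         : ℚ → Set
    L-inhabited : ∃[ q ] L q
    U-inhabited : ∃[ q ] U q
    L-lower     : ∀ {p q} → p < q → L q → L p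
    U-upper     : ∀ {p q} → p < q → U p → U q
    L-open      : ∀ {p} → L p → ∃[ q ] (p < q × L q)
    U-open      : ∀ {q} → U q → ∃[ p ] (p < q × U p)
    disjoint    : ∀ {q} → L q → U q → ⊥
    located     : ∀ {p q} → p < q → L p ⊎ U q

-- | x - q | < ε, i.e. q - ε < x < q + ε
_isWithin_of_ : ℝ → ℚ → ℚ → Set
x isWithin ε of q = ℝ.L x (q - ε) × ℝ.U x (q + ε)

_ConvergesTo_ : (ℕ → ℚ) → ℝ → Set
s ConvergesTo x =
  ∀ ε → 0ℚ < ε → ∃[ N ] (∀ n → N ℕ.≤ n → x isWithin ε of s n)

{-# OPTIONS --safe #-}
-- Since F (n+1) ≤ 2 F n for n ≥ 1, one has 1 / F (n+1) ≤ r n - r (n+1) for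
-- r n = 6 / F (n+2).  As |μ| ≤ 1, the intervals [S n - r n , S n + r n] around
-- the partial sums S n are nested, and they shrink to a point C.  Each of them
-- encloses C and all later partial sums: the fifth one is already negative, and
-- the fiftieth gives the digits of C.
module Submission where

open import Defs
open import Data.Bool.Base using (true; false)
open import Data.Integer.Base as ℤ using (ℤ; +_; -[1+_]; +[1+_]; +≤+; +<+; 0ℤ; 1ℤ; -1ℤ)
open import Data.Integer.DivMod using ([n/ℕd]*d≤n; n<s[n/ℕd]*d)
import Data.Integer.Properties as ℤₚ
import Data.Integer.Solver as ℤ-Solver
open import Data.List.Base using (length)
open import Data.List.Relation.Unary.Unique.DecPropositional using (unique?)
open import Data.Nat.Base as ℕ using (ℕ; zero; suc; NonZero; _≤_)
open import Data.Nat.Primality.Factorisation using (factorise; factors)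
import Data.Nat.Properties as ℕₚ
import Data.Nat.Solver as ℕ-Solver
open import Data.Product.Base using (Σ-syntax; ∃-syntax; _×_; _,_; proj₁; proj₂)
open import Data.Rational.Base as ℚ using (ℚ; mkℚ; 0ℚ; _/_; -_; _+_; _-_; _<_; *<*; toℚᵘ; fromℚᵘ)
import Data.Rational.Properties as ℚₚ
import Data.Rational.Solver as ℚ-Solver
open import Data.Rational.Unnormalised.Base as ℚᵘ using (mkℚᵘ)
import Data.Rational.Unnormalised.Properties as ℚᵘₚ
open import Data.Sum.Base using (inj₁; inj₂)
open import Level using (0ℓ)
open import Relation.Binary.Core using (Rel)
open import Relation.Binary.Definitions using (Reflexive; Transitive)
open import Relation.Binary.PropositionalEquality
open import Relation.Nullary.Decidable using (does; yes; no; from-yes; True; toWitness)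

-- An arbitrary reflexive transitive relation lets one proof serve increasing `l` and, with the
-- order reversed, decreasing `u`. The recursion is on `≤′`, which grows at its upper end just as
-- `step` does.
step⇒mono : ∀ {A : Set} {_≲_ : Rel A 0ℓ} → Reflexive _≲_ → Transitive _≲_ →
            (f : ℕ → A) → (∀ n → f n ≲ f (suc n)) → ∀ {m n} → m ≤ n → f m ≲ f n
step⇒mono {_≲_ = _≲_} rfl trns f step m≤n = go (ℕₚ.≤⇒≤′ m≤n)
  where
  go : ∀ {m n} → m ℕ.≤′ n → f m ≲ f n
  go (ℕ.≤′-reflexive refl) = rfl
  go (ℕ.≤′-step m≤n)       = trns (go m≤n) (step _)

-- Fractions

toℚᵘ-/ : ∀ i n → toℚᵘ (i / suc n) ℚᵘ.≃ mkℚᵘ i n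
toℚᵘ-/ i n = ℚₚ.toℚᵘ-fromℚᵘ (mkℚᵘ i n)

-- Since `_/_` reduces to lowest terms, the comparison is moved to unnormalised rationals, whose
-- order is cross-multiplication by definition.
cross-≤⇒/≤/ : ∀ i j m n .{{_ : NonZero m}} .{{_ : NonZero n}} →
           i ℤ.* + n ℤ.≤ j ℤ.* + m → i / m ℚ.≤ j / n
cross-≤⇒/≤/ i j (suc m) (suc n) le = ℚₚ.toℚᵘ-cancel-≤ (begin
  toℚᵘ (i / suc m)  ≃⟨ toℚᵘ-/ i m ⟩
  mkℚᵘ i m          ≤⟨ ℚᵘ.*≤* le ⟩
  mkℚᵘ j n          ≃⟨ toℚᵘ-/ j n ⟨
  toℚᵘ (j / suc n)  ∎)
  where open ℚᵘₚ.≤-Reasoning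

cross-<⇒/</ : ∀ i j m n .{{_ : NonZero m}} .{{_ : NonZero n}} →
           i ℤ.* + n ℤ.< j ℤ.* + m → i / m < j / n
cross-<⇒/</ i j (suc m) (suc n) lt = ℚₚ.toℚᵘ-cancel-< (begin-strict
  toℚᵘ (i / suc m)  ≃⟨ toℚᵘ-/ i m ⟩
  mkℚᵘ i m          <⟨ ℚᵘ.*<* lt ⟩
  mkℚᵘ j n          ≃⟨ toℚᵘ-/ j n ⟨
  toℚᵘ (j / suc n)  ∎)
  where open ℚᵘₚ.≤-Reasoning

/-+-/ : ∀ i j m n .{{_ : NonZero m}} .{{_ : NonZero n}} →
        i / m + j / n ≡ ((i ℤ.* + n ℤ.+ j ℤ.* + m) / (m ℕ.* n)) {{ℕₚ.m*n≢0 m n}}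
/-+-/ i j (suc m) (suc n) = begin
  i / suc m + j / suc n                 ≡⟨ ℚₚ.fromℚᵘ-toℚᵘ _ ⟨
  fromℚᵘ (toℚᵘ (i / suc m + j / suc n)) ≡⟨ ℚₚ.fromℚᵘ-cong {y = mkℚᵘ i m ℚᵘ.+ mkℚᵘ j n}
                                             (ℚᵘₚ.≃-trans (ℚₚ.toℚᵘ-homo-+ (i / suc m) (j / suc n))
                                               (ℚᵘₚ.+-cong (toℚᵘ-/ i m) (toℚᵘ-/ j n))) ⟩
  fromℚᵘ (mkℚᵘ i m ℚᵘ.+ mkℚᵘ j n)       ∎
  where open ≡-Reasoning

/-distribʳ-+ : ∀ i j n .{{_ : NonZero n}} → (i ℤ.+ j) / n ≡ i / n + j / n
/-distribʳ-+ i j n@(suc n-1) = begin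
  (i ℤ.+ j) / n                                        ≡⟨ ℚₚ.fromℚᵘ-cong {mkℚᵘ (i ℤ.+ j) n-1} {mkℚᵘ i n-1 ℚᵘ.+ mkℚᵘ j n-1}
                                                            (ℚᵘ.*≡* cross) ⟩
  (i ℤ.* + n ℤ.+ j ℤ.* + n) / (n ℕ.* n)                ≡⟨ /-+-/ i j n n ⟨
  i / n + j / n                                        ∎
  where
  open ≡-Reasoning
  open ℤ-Solver.+-*-Solver
  cross : (i ℤ.+ j) ℤ.* (+ n ℤ.* + n) ≡ (i ℤ.* + n ℤ.+ j ℤ.* + n) ℤ.* + n
  cross = solve 3 (λ i j n → (i :+ j) :* (n :* n) := (i :* n :+ j :* n) :* n) refl i j (+ n)

-- Limits of nested intervals

module NestedIntervals
  (l u : ℕ → ℚ)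
  (l-step : ∀ n → l n ℚ.≤ l (suc n))
  (u-step : ∀ n → u (suc n) ℚ.≤ u n)
  (l≤u : ∀ n → l n ℚ.≤ u n)
  (shrinking : ∀ ε → 0ℚ < ε → ∃[ n ] u n < l n + ε)
  where

  l-mono : ∀ {m n} → m ≤ n → l m ℚ.≤ l n
  l-mono = step⇒mono {_≲_ = ℚ._≤_} ℚₚ.≤-refl ℚₚ.≤-trans l l-step

  u-anti : ∀ {m n} → m ≤ n → u n ℚ.≤ u m
  u-anti = step⇒mono {_≲_ = ℚ._≥_} ℚₚ.≤-refl (λ p q → ℚₚ.≤-trans q p) u u-step

  l≤u′ : ∀ m n → l m ℚ.≤ u n
  l≤u′ m n = begin
    l m          ≤⟨ l-mono (ℕₚ.m≤m⊔n m n) ⟩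
    l (m ℕ.⊔ n)  ≤⟨ l≤u (m ℕ.⊔ n) ⟩
    u (m ℕ.⊔ n)  ≤⟨ u-anti (ℕₚ.m≤n⊔m m n) ⟩
    u n          ∎
    where open ℚₚ.≤-Reasoning

  -- The common value of the supremum of `l` and the infimum of `u`. Strict inequalities in both
  -- cuts make them open, by density of the rationals.
  limit : ℝ
  limit = record
    { L           = λ q → ∃[ n ] q < l n
    ; U           = λ q → ∃[ n ] u n < q
    ; L-inhabited = l 0 - ℚ.1ℚ , 0 , (begin-strict
        l 0 - ℚ.1ℚ  <⟨ ℚₚ.+-monoʳ-< (l 0) (from-yes (- ℚ.1ℚ ℚₚ.<? 0ℚ)) ⟩
        l 0 + 0ℚ    ≡⟨ ℚₚ.+-identityʳ (l 0) ⟩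
        l 0         ∎)
    ; U-inhabited = u 0 + ℚ.1ℚ , 0 , (begin-strict
        u 0         ≡⟨ ℚₚ.+-identityʳ (u 0) ⟨
        u 0 + 0ℚ    <⟨ ℚₚ.+-monoʳ-< (u 0) (from-yes (0ℚ ℚₚ.<? ℚ.1ℚ)) ⟩
        u 0 + ℚ.1ℚ  ∎)
    ; L-lower     = λ p<q (n , q<l) → n , ℚₚ.<-trans p<q q<l
    ; U-upper     = λ p<q (n , u<p) → n , ℚₚ.<-trans u<p p<q
    ; L-open      = λ (n , p<l) → let q , p<q , q<l = ℚₚ.<-dense p<l in q , p<q , n , q<l
    ; U-open      = λ (n , u<q) → let p , u<p , p<q = ℚₚ.<-dense u<q in p , p<q , n , u<p
    ; disjoint    = λ (m , q<l) (n , u<q) →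
        ℚₚ.<-irrefl refl (ℚₚ.<-trans u<q (ℚₚ.<-≤-trans q<l (l≤u′ m n)))
    ; located     = located
    }
    where
    open ℚₚ.≤-Reasoning
    -- An interval shorter than `q - p` cannot reach both down to `p` and up to `q`, so comparing
    -- `p` with its left end decides.
    located : ∀ {p q} → p < q → _
    located {p} {q} p<q with shrinking (q - p) (subst (_< q - p) (ℚₚ.+-inverseʳ p) (ℚₚ.+-monoˡ-< (- p) p<q))
    ... | n , u<l+[q-p] with p ℚₚ.<? l n
    ...   | yes p<l = inj₁ (n , p<l)
    ...   | no  p≮l = inj₂ (n , (begin-strict
      u n            <⟨ u<l+[q-p] ⟩
      l n + (q - p)  ≤⟨ ℚₚ.+-monoˡ-≤ (q - p) (ℚₚ.≮⇒≥ p≮l) ⟩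
      p + (q - p)    ≡⟨ solve 2 (λ p q → p :+ (q :- p) := q) refl p q ⟩
      q              ∎))
      where open ℚ-Solver.+-*-Solver

  -- For `n ≥ N`, both `s n` and the limit lie in the `N`-th interval, whose length is below `ε`.
  squeeze : ∀ s → (∀ n → l n ℚ.≤ s n) → (∀ n → s n ℚ.≤ u n) → s ConvergesTo limit
  squeeze s l≤s s≤u ε 0<ε with N , u<l+ε ← shrinking ε 0<ε = N , λ n N≤n →
      (N , (begin-strict
        s n - ε        ≤⟨ ℚₚ.+-monoˡ-≤ (- ε) (ℚₚ.≤-trans (s≤u n) (u-anti N≤n)) ⟩
        u N - ε        <⟨ ℚₚ.+-monoˡ-< (- ε) u<l+ε ⟩
        l N + ε - ε    ≡⟨ solve 2 (λ l e → l :+ e :- e := l) refl (l N) ε ⟩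
        l N            ∎))
    , (N , (begin-strict
        u N            <⟨ u<l+ε ⟩
        l N + ε        ≤⟨ ℚₚ.+-monoˡ-≤ ε (ℚₚ.≤-trans (l-mono N≤n) (l≤s n)) ⟩
        s n + ε        ∎))
    where
    open ℚₚ.≤-Reasoning
    open ℚ-Solver.+-*-Solver

-- Bounds on F and μ

-- Linear growth is enough to give an explicit index in `radius-vanishes`.
n≤F[1+n] : ∀ n → n ≤ F (suc n)
n≤F[1+n] 0             = ℕ.z≤n
n≤F[1+n] 1             = ℕₚ.≤-refl
n≤F[1+n] (suc (suc n)) = subst (_≤ F (suc (suc n)) ℕ.+ F (suc n)) (ℕₚ.+-comm (suc n) 1)
  (ℕₚ.+-mono-≤ (n≤F[1+n] (suc n)) (ℕ.>-nonZero⁻¹ (F (suc n)) {{F-nonZero n}}))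

F≤F[1+n] : ∀ n → F n ≤ F (suc n)
F≤F[1+n] 0       = ℕ.z≤n
F≤F[1+n] (suc n) = ℕₚ.m≤m+n (F (suc n)) (F n)

F[2+n]≤2F[1+n] : ∀ n → F (2 ℕ.+ n) ≤ 2 ℕ.* F (suc n)
F[2+n]≤2F[1+n] n = ℕₚ.+-monoʳ-≤ (F (suc n)) (ℕₚ.≤-trans (F≤F[1+n] n) (ℕₚ.m≤m+n _ 0))

-1^n-bounds : ∀ n → -1ℤ ℤ.≤ -1ℤ ℤ.^ n × -1ℤ ℤ.^ n ℤ.≤ 1ℤ
-1^n-bounds zero    = ℤ.-≤+ , ℤₚ.≤-refl
-1^n-bounds (suc n) with lo , hi ← -1^n-bounds n =
  subst (λ i → -1ℤ ℤ.≤ i × i ℤ.≤ 1ℤ) (sym (ℤₚ.-1*i≡-i (-1ℤ ℤ.^ n)))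
    (ℤₚ.neg-mono-≤ hi , ℤₚ.neg-mono-≤ lo)

μ-bounds : ∀ n .{{_ : NonZero n}} → -1ℤ ℤ.≤ μ n × μ n ℤ.≤ 1ℤ
μ-bounds n with does (unique? ℕₚ._≟_ (factors (factorise n)))
... | true  = -1^n-bounds (length (factors (factorise n)))
... | false = ℤ.-≤+ , +≤+ ℕ.z≤n

-- The enclosing intervals

infixl 7 _/F_
_/F_ : ℤ → ℕ → ℚ
i /F n = (i / F (suc n)) {{F-nonZero n}}

/F-mono-≤ : ∀ i j n → i ℤ.≤ j → i /F n ℚ.≤ j /F n
/F-mono-≤ i j n i≤j = cross-≤⇒/≤/ i j (F (suc n)) (F (suc n)) {{F-nonZero n}} {{F-nonZero n}}
  (ℤₚ.*-monoʳ-≤-nonNeg (+ F (suc n)) i≤j)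

term : ℕ → ℚ
term n = μ (suc n) /F n

term-lower : ∀ n → - (1ℤ /F n) ℚ.≤ term n
term-lower n = /F-mono-≤ -1ℤ (μ (suc n)) n (proj₁ (μ-bounds (suc n)))

term-upper : ∀ n → term n ℚ.≤ 1ℤ /F n
term-upper n = /F-mono-≤ (μ (suc n)) 1ℤ n (proj₂ (μ-bounds (suc n)))

radius : ℕ → ℚ
radius n = + 6 /F suc n

radius≥0 : ∀ n → 0ℚ ℚ.≤ radius n
radius≥0 n = cross-≤⇒/≤/ 0ℤ (+ 6) 1 (F (2 ℕ.+ n)) {{_}} {{F-nonZero (suc n)}} (+≤+ ℕ.z≤n)

-- Clearing denominators and cancelling 6ab leaves b(b+a) ≤ 6a², which holds because b ≤ 2a and b+a
-- ≤ 3a. This is where the constant 6 = 2·3 of `radius` comes from.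
1/a+6/[b+a]≤6/b : ∀ a b .{{_ : NonZero a}} .{{_ : NonZero b}} .{{_ : NonZero (b ℕ.+ a)}} →
                  b ≤ 2 ℕ.* a → 1ℤ / a + + 6 / (b ℕ.+ a) ℚ.≤ + 6 / b
1/a+6/[b+a]≤6/b a b b≤2a =
  subst (ℚ._≤ + 6 / b) (sym (/-+-/ 1ℤ (+ 6) a (b ℕ.+ a)))
    (cross-≤⇒/≤/ (1ℤ ℤ.* + (b ℕ.+ a) ℤ.+ + 6 ℤ.* + a) (+ 6) (a ℕ.* (b ℕ.+ a)) b {{ℕₚ.m*n≢0 a (b ℕ.+ a)}}
      (subst₂ ℤ._≤_ lhs (ℤₚ.pos-* 6 (a ℕ.* (b ℕ.+ a))) (+≤+ cross)))
  where
  lhs : + ((1 ℕ.* (b ℕ.+ a) ℕ.+ 6 ℕ.* a) ℕ.* b) ≡ (1ℤ ℤ.* + (b ℕ.+ a) ℤ.+ + 6 ℤ.* + a) ℤ.* + b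
  lhs = trans (ℤₚ.pos-* (1 ℕ.* (b ℕ.+ a) ℕ.+ 6 ℕ.* a) b)
    (cong (ℤ._* + b) (cong₂ ℤ._+_ (ℤₚ.pos-* 1 (b ℕ.+ a)) (ℤₚ.pos-* 6 a)))
  open ℕ-Solver.+-*-Solver
  open ℕₚ.≤-Reasoning
  cross : (1 ℕ.* (b ℕ.+ a) ℕ.+ 6 ℕ.* a) ℕ.* b ≤ 6 ℕ.* (a ℕ.* (b ℕ.+ a))
  cross = begin
    (1 ℕ.* (b ℕ.+ a) ℕ.+ 6 ℕ.* a) ℕ.* b
      ≡⟨ solve 2 (λ a b → (con 1 :* (b :+ a) :+ con 6 :* a) :* b
                       := b :* (b :+ a) :+ con 6 :* a :* b) refl a b ⟩
    b ℕ.* (b ℕ.+ a) ℕ.+ 6 ℕ.* a ℕ.* b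
      ≤⟨ ℕₚ.+-monoˡ-≤ _ (ℕₚ.*-mono-≤ b≤2a (ℕₚ.+-monoˡ-≤ a b≤2a)) ⟩
    2 ℕ.* a ℕ.* (2 ℕ.* a ℕ.+ a) ℕ.+ 6 ℕ.* a ℕ.* b
      ≡⟨ solve 2 (λ a b → con 2 :* a :* (con 2 :* a :+ a) :+ con 6 :* a :* b
                       := con 6 :* (a :* (b :+ a))) refl a b ⟩
    6 ℕ.* (a ℕ.* (b ℕ.+ a)) ∎

-- The case a = `F (1+n)`, b = `F (2+n)`, where b+a is `F (3+n)` by definition.
radius-step : ∀ n → 1ℤ /F n + radius (suc n) ℚ.≤ radius n
radius-step n = 1/a+6/[b+a]≤6/b (F (suc n)) (F (2 ℕ.+ n))
  {{F-nonZero n}} {{F-nonZero (suc n)}} {{F-nonZero (suc (suc n))}} (F[2+n]≤2F[1+n] n)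

lower upper : ℕ → ℚ
lower n = partialSum n - radius n
upper n = partialSum n + radius n

-- The new term moves the sum by at most `1ℤ /F n`, and the radius shrinks by at least as much;
-- `upper-step` is the mirror image.
lower-step : ∀ n → lower n ℚ.≤ lower (suc n)
lower-step n = begin
  S - radius n                          ≤⟨ ℚₚ.+-monoʳ-≤ S (ℚₚ.neg-antimono-≤ (radius-step n)) ⟩
  S - (1/F + radius (suc n))            ≡⟨ solve 3 (λ s b r → s :- (b :+ r) := s :+ (:- b) :- r) refl
                                             S 1/F (radius (suc n)) ⟩
  S + (- 1/F) - radius (suc n)          ≤⟨ ℚₚ.+-monoˡ-≤ (- radius (suc n)) (ℚₚ.+-monoʳ-≤ S (term-lower n)) ⟩
  S + term n - radius (suc n)           ∎
  where
  open ℚₚ.≤-Reasoning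
  open ℚ-Solver.+-*-Solver
  S   = partialSum n
  1/F = 1ℤ /F n

upper-step : ∀ n → upper (suc n) ℚ.≤ upper n
upper-step n = begin
  S + term n + radius (suc n)             ≡⟨ ℚₚ.+-assoc S (term n) (radius (suc n)) ⟩
  S + (term n + radius (suc n))           ≤⟨ ℚₚ.+-monoʳ-≤ S (ℚₚ.+-monoˡ-≤ (radius (suc n)) (term-upper n)) ⟩
  S + (1ℤ /F n + radius (suc n))   ≤⟨ ℚₚ.+-monoʳ-≤ S (radius-step n) ⟩
  S + radius n                            ∎
  where
  open ℚₚ.≤-Reasoning
  S = partialSum n

lower≤partialSum : ∀ n → lower n ℚ.≤ partialSum n
lower≤partialSum n = begin
  partialSum n - radius n  ≤⟨ ℚₚ.+-monoʳ-≤ (partialSum n) (ℚₚ.neg-antimono-≤ (radius≥0 n)) ⟩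
  partialSum n + 0ℚ        ≡⟨ ℚₚ.+-identityʳ (partialSum n) ⟩
  partialSum n             ∎
  where open ℚₚ.≤-Reasoning

partialSum≤upper : ∀ n → partialSum n ℚ.≤ upper n
partialSum≤upper n = begin
  partialSum n             ≡⟨ ℚₚ.+-identityʳ (partialSum n) ⟨
  partialSum n + 0ℚ        ≤⟨ ℚₚ.+-monoʳ-≤ (partialSum n) (radius≥0 n) ⟩
  partialSum n + radius n  ∎
  where open ℚₚ.≤-Reasoning

radius-vanishes : ∀ ε → 0ℚ < ε → ∃[ n ] radius n + radius n < ε
radius-vanishes (mkℚ (+ 0)    _ _)     (*<* (+<+ ()))
radius-vanishes (mkℚ -[1+ _ ] _ _)     (*<* ())
radius-vanishes ε@(mkℚ +[1+ a ] d-1 _) _ = N ,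
  subst₂ _<_ (/-distribʳ-+ (+ 6) (+ 6) (F (2 ℕ.+ N)) {{F-nonZero (suc N)}}) (ℚₚ.↥p/↧p≡p ε)
    (cross-<⇒/</ (+ 12) +[1+ a ] (F (2 ℕ.+ N)) (suc d-1) {{F-nonZero (suc N)}}
      (subst₂ ℤ._<_ (ℤₚ.pos-* 12 (suc d-1)) (ℤₚ.pos-* (suc a) (F (2 ℕ.+ N)))
        (+<+ (ℕₚ.≤-trans (n≤F[1+n] (suc N)) (ℕₚ.m≤m+n (F (2 ℕ.+ N)) _)))))
  where
  -- With ε = (a+1)/d the goal is 12d < (a+1)·`F (2+N)`, and `F (2+N)` ≥ N+1 = 12d+1.
  N = 12 ℕ.* suc d-1

shrinking : ∀ ε → 0ℚ < ε → ∃[ n ] upper n < lower n + ε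
shrinking ε 0<ε = let n , r+r<ε = radius-vanishes ε 0<ε in n , (begin-strict
  partialSum n + radius n                            ≡⟨ solve 2 (λ s r → s :+ r := s :- r :+ (r :+ r)) refl
                                                          (partialSum n) (radius n) ⟩
  partialSum n - radius n + (radius n + radius n)    <⟨ ℚₚ.+-monoʳ-< (lower n) r+r<ε ⟩
  partialSum n - radius n + ε                        ∎)
  where
  open ℚₚ.≤-Reasoning
  open ℚ-Solver.+-*-Solver

open NestedIntervals lower upper lower-step upper-step
  (λ n → ℚₚ.≤-trans (lower≤partialSum n) (partialSum≤upper n)) shrinking

-- Numerical evaluation

-- F takes exponentially many steps to evaluate, fastF only linearly many.
fastFrom : ℕ → ℕ → ℕ → ℕ
fastFrom a b zero    = a
fastFrom a b (suc n) = fastFrom b (b ℕ.+ a) n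

fastF : ℕ → ℕ
fastF = fastFrom 0 1

-- The start `m` is kept general because each recursive call shifts the window (`F m`, `F (suc m)`)
-- by one.
fastFrom-F : ∀ m n → fastFrom (F m) (F (suc m)) n ≡ F (n ℕ.+ m)
fastFrom-F m zero    = refl
fastFrom-F m (suc n) = trans (fastFrom-F (suc m) n) (cong F (ℕₚ.+-suc n m))

fastF≡F : ∀ n → fastF n ≡ F n
fastF≡F n = trans (fastFrom-F 0 n) (cong F (ℕₚ.+-identityʳ n))

fastF-nonZero : ∀ n → NonZero (fastF (suc n))
fastF-nonZero n = subst NonZero (sym (fastF≡F (suc n))) (F-nonZero n)

infixl 7 _/fastF_
_/fastF_ : ℤ → ℕ → ℚ
i /fastF n = (i / fastF (suc n)) {{fastF-nonZero n}}

/fastF≡/F : ∀ i n → i /fastF n ≡ i /F n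
/fastF≡/F i n = ℚₚ./-cong {i} {p₂ = i} {{fastF-nonZero n}} {{F-nonZero n}} refl (fastF≡F (suc n))

-- Exact partial sums have huge denominators, so they are enclosed in fixed-point
-- arithmetic instead, rounding every term down.
precision : ℕ
precision = 10 ℕ.^ 12

scaledTerm scaledSum : ℕ → ℤ
scaledTerm n = ((μ (suc n) ℤ.* + precision) ℤ./ℕ fastF (suc n)) {{fastF-nonZero n}}
scaledSum zero    = 0ℤ
scaledSum (suc n) = scaledSum n ℤ.+ scaledTerm n

-- Division by `_/ℕ_` takes the floor for negative numerators too, so terms with μ = -1 are also
-- rounded down.
scaledTerm-lower : ∀ n → scaledTerm n / precision ℚ.≤ term n
scaledTerm-lower n = subst (scaledTerm n / precision ℚ.≤_) (/fastF≡/F (μ (suc n)) n)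
  (cross-≤⇒/≤/ (scaledTerm n) (μ (suc n)) precision (fastF (suc n)) {{_}} {{fastF-nonZero n}}
    ([n/ℕd]*d≤n (μ (suc n) ℤ.* + precision) (fastF (suc n)) {{fastF-nonZero n}}))

scaledTerm-upper : ∀ n → term n ℚ.≤ ℤ.suc (scaledTerm n) / precision
scaledTerm-upper n = subst (ℚ._≤ ℤ.suc (scaledTerm n) / precision) (/fastF≡/F (μ (suc n)) n)
  (cross-≤⇒/≤/ (μ (suc n)) (ℤ.suc (scaledTerm n)) (fastF (suc n)) precision {{fastF-nonZero n}}
    (ℤₚ.<⇒≤ (n<s[n/ℕd]*d (μ (suc n) ℤ.* + precision) (fastF (suc n)) {{fastF-nonZero n}})))

scaledSum-lower : ∀ n → scaledSum n / precision ℚ.≤ partialSum n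
scaledSum-lower zero    = ℚₚ.≤-refl
scaledSum-lower (suc n) = begin
  (scaledSum n ℤ.+ scaledTerm n) / precision           ≡⟨ /-distribʳ-+ (scaledSum n) (scaledTerm n) precision ⟩
  scaledSum n / precision + scaledTerm n / precision   ≤⟨ ℚₚ.+-mono-≤ (scaledSum-lower n) (scaledTerm-lower n) ⟩
  partialSum n + term n                                ∎
  where open ℚₚ.≤-Reasoning

-- Each of the `n` floors loses at most one unit of 1 / `precision`, hence the correction `+ n`.
scaledSum-upper : ∀ n → partialSum n ℚ.≤ (scaledSum n ℤ.+ + n) / precision
scaledSum-upper zero    = ℚₚ.≤-refl
scaledSum-upper (suc n) = begin
  partialSum n + term n
    ≤⟨ ℚₚ.+-mono-≤ (scaledSum-upper n) (scaledTerm-upper n) ⟩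
  (scaledSum n ℤ.+ + n) / precision + ℤ.suc (scaledTerm n) / precision
    ≡⟨ /-distribʳ-+ (scaledSum n ℤ.+ + n) (ℤ.suc (scaledTerm n)) precision ⟨
  (scaledSum n ℤ.+ + n ℤ.+ ℤ.suc (scaledTerm n)) / precision
    ≡⟨ cong (_/ precision) (solve 3 (λ s t n → s :+ n :+ (con 1ℤ :+ t) := s :+ t :+ (con 1ℤ :+ n)) refl
         (scaledSum n) (scaledTerm n) (+ n)) ⟩
  (scaledSum n ℤ.+ scaledTerm n ℤ.+ + suc n) / precision ∎
  where
  open ℚₚ.≤-Reasoning
  open ℤ-Solver.+-*-Solver

-- The comparison involves only quantities that evaluate cheaply, so type checking can decide it;
-- the result then carries over to the true endpoint `lower n`.
<scaledSum⇒<limit : ∀ n q → True (q ℚₚ.<? scaledSum n / precision - + 6 /fastF suc n) → ℝ.L limit q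
<scaledSum⇒<limit n q q< = n , ℚₚ.<-≤-trans (toWitness q<)
  (ℚₚ.+-mono-≤ (scaledSum-lower n) (ℚₚ.≤-reflexive (cong -_ (/fastF≡/F (+ 6) (suc n)))))

scaledSum<⇒limit< : ∀ n q → True ((scaledSum n ℤ.+ + n) / precision + + 6 /fastF suc n ℚₚ.<? q) → ℝ.U limit q
scaledSum<⇒limit< n q <q = n , ℚₚ.≤-<-trans
  (ℚₚ.+-mono-≤ (scaledSum-upper n) (ℚₚ.≤-reflexive (sym (/fastF≡/F (+ 6) (suc n))))) (toWitness <q)

-- At n = 50 the rounding error is at most 50·10⁻¹² and the radius 6/F₅₂ is below 2·10⁻¹⁰, both well
-- under the tolerance 5·10⁻⁹.
limit-digits : limit isWithin (+ 5 / 1000000000) of (- (+ 64572472 / 100000000))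
limit-digits =
    -- The placeholders are the rational bound, fixed by the goal, and the evidence of the decided
    -- comparison.
    <scaledSum⇒<limit 50 _ _
  , scaledSum<⇒limit< 50 _ _

-- Sign of the partial sums

partialSum<0 : ∀ n → 3 ≤ n → partialSum n < 0ℚ
partialSum<0 0 ()
partialSum<0 1 (ℕ.s≤s ())
partialSum<0 2 (ℕ.s≤s (ℕ.s≤s ()))
-- `upper 3` = 7/10 and `upper 4` = 1/4 are still positive, so these two sums are evaluated
-- directly.
partialSum<0 3 _ = from-yes (partialSum 3 ℚₚ.<? 0ℚ)
partialSum<0 4 _ = from-yes (partialSum 4 ℚₚ.<? 0ℚ)
partialSum<0 n@(suc (suc (suc (suc (suc k))))) _ = begin-strict
  partialSum n  ≤⟨ partialSum≤upper n ⟩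
  upper n       ≤⟨ u-anti (ℕₚ.m≤m+n 5 k) ⟩
  -- The fifth sum is -1/2 - 1/5 = -7/10, and `radius 5` = 6/13 is smaller than 7/10.
  upper 5       <⟨ from-yes (upper 5 ℚₚ.<? 0ℚ) ⟩
  0ℚ            ∎
  where open ℚₚ.≤-Reasoning

theorem2 : (Σ[ C ∈ ℝ ]
    (partialSum ConvergesTo C
    × C isWithin (+ 5 / 1000000000) of (- (+ 64572472 / 100000000))))
    × (∀ n → 3 ≤ n → partialSum n < 0ℚ)
theorem2 =
  (limit , squeeze partialSum lower≤partialSum partialSum≤upper , limit-digits) , partialSum<0
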